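{- For all integers $k \geq 0$ and $n \geq 0$, the number of vertices labeled by $n$ in the $k$-extended action graph $A^k_n$ is equal to $C^k_n$, the $n$th term of the $k$th self-convolution of the Catalan sequence.
   Context: Catalan numbers: $C_0 = 1$ and $C_{n+1} = \sum_{i=0}^n C_i C_{n-i}$ for $n \geq 0$. Self-convolutions: the convolution of two sequences $A = (A_n)_{n\ge 0}$ and $B = (B_n)_{n \ge 0}$ is $(A \ast B)_n = \sum_{m=0}^n A_m B_{n-m}$. For $k \geq 0$, $C^k$ denotes the sequence $C \ast \cdots \ast C$ with $k+1$ factors, where $C = (C_n)_{n\ge0}$; in particular $C^0 = C$ and $C^1 = C \ast C$. Its $n$th term is denoted $C^k_n$. Directed graphs: a directed graph is a pair $(V,E)$ where $V$ is a set of vertices and $E$ is a set of ordered pairs of vertices, called edges; the edge $e=(v,w)$ has source $s(e) = v$ and target $t(e) = w$. It is assumed that $(v,v) \in E$ for every $v \in V$; these edges are called trivial edges, and there are no other loops and no multiple edges. A (directed) path is a sequence of edges $e_1, \ldots, e_m$ ($m \geq 1$) with $t(e_i) = s(e_{i+1})$ for $1 \leq i < m$, where if $m > 1$ all the edges are required to be nontrivial. Its initial vertex is $s(e_1)$ and its terminal vertex is $t(e_m)$. In particular, each vertex $v$ gives exactly one trivial path from $v$ to $v$. A labeling of a directed graph by a set $S$ is a function $V \to S$. $k$-extended action graphs: for $k \geq 0$, the graphs $A^k_n$, $n \geq 0$, are directed graphs labeled by $\mathbb{N} \cup \{ -k, -k+1, \ldots, -1\}$ (with $0\in\mathbb{N}$;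 for $k=0$ the label set is $\mathbb{N}$), defined inductively. The graph $A^k_0$ is the linear graph $\bullet_{ -k} \to \bullet_{ -k+1} \to \cdots \to \bullet_{ -1} \to \bullet_0$ with $k+1$ vertices labeled $-k, \ldots, 0$ (for $k=0$ it is a single vertex labeled $0$ with no nontrivial edges). Given $A^k_n$, the graph $A^k_{n+1}$ is obtained by freely adjoining new edges as follows: for each vertex $v$ of $A^k_n$ labeled by $n$ and each path in $A^k_n$ with terminal vertex $v$ (including the trivial path at $v$), adjoin one new edge whose source is the initial vertex of that path and whose target is a new vertex labeled by $n+1$ (distinct paths give distinct new vertices). -}

module Defs where

open import Data.Fin using (Fin; toℕ)
open import Data.Integer as ℤ using (ℤ; +_)
import Data.Integer.Properties as ℤ
import Data.Irrelevant as Irr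
open import Data.List using (map; upTo)
open import Data.List.Properties using (map-cong-local)
open import Data.List.Relation.Unary.All using (tabulate)
open import Data.List.Membership.Propositional.Properties using (∈-upTo⁻)
open import Data.Nat using (ℕ; zero; suc; _+_; _*_; _∸_; _≤_; s≤s)
open import Data.Nat.ListAction using (sum)
import Data.Nat.Properties as ℕ
open import Data.Product using (∃; _×_; _,_)
open import Data.Refinement using (Refinement-syntax; _,_)
open import Data.Sum using (_⊎_; inj₁; inj₂)
open import Relation.Binary.Construct.Closure.Transitive using (TransClosure)
open import Relation.Binary.Definitions using (Reflexive; Irrelevant)
open import Relation.Binary.PropositionalEquality
open import Relation.Nullary using (contradiction)

infixl 7 _∗_

_∗_ : (ℕ → ℕ) → (ℕ → ℕ) → (ℕ → ℕ)
(a ∗ b) n = sum (map (λ m → a m * b (n ∸ m)) (upTo (suc n)))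

-- Only the values at arguments ≤ the first argument are meaningful: that
-- argument bounds the recursion depth.  The defining recurrence of the
-- Catalan sequence is catalan-suc below.
catalanUpTo : ℕ → ℕ → ℕ
catalanUpTo _       zero    = 1
catalanUpTo zero    (suc n) = 0
catalanUpTo (suc d) (suc n) = (catalanUpTo d ∗ catalanUpTo d) n

catalan : ℕ → ℕ
catalan n = catalanUpTo n n

∗-cong-≤ : ∀ {a a′ b b′ : ℕ → ℕ} n →
           (∀ {m} → m ≤ n → a m ≡ a′ m) →
           (∀ {m} → m ≤ n → b m ≡ b′ m) →
           (a ∗ b) n ≡ (a′ ∗ b′) n
∗-cong-≤ n a≡a′ b≡b′ = cong sum (map-cong-local (tabulate λ {m} m∈ →
  cong₂ _*_ (a≡a′ (ℕ.≤-pred (∈-upTo⁻ m∈))) (b≡b′ (ℕ.m∸n≤m n m))))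

catalanUpTo-stable : ∀ d e {n} → n ≤ d → n ≤ e → catalanUpTo d n ≡ catalanUpTo e n
catalanUpTo-stable d       e       {zero}  _         _         = refl
catalanUpTo-stable (suc d) (suc e) {suc n} (s≤s n≤d) (s≤s n≤e) =
  ∗-cong-≤ n step step
  where
  step : ∀ {m} → m ≤ n → catalanUpTo d m ≡ catalanUpTo e m
  step m≤n = catalanUpTo-stable d e (ℕ.≤-trans m≤n n≤d) (ℕ.≤-trans m≤n n≤e)

catalan-zero : catalan 0 ≡ 1
catalan-zero = refl

catalan-suc : ∀ n → catalan (suc n) ≡ (catalan ∗ catalan) n
catalan-suc n = ∗-cong-≤ n step step
  where
  step : ∀ {m} → m ≤ n → catalanUpTo n m ≡ catalan m
  step {m} m≤n = catalanUpTo-stable n m m≤n ℕ.≤-refl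

-- catalan^ k has k + 1 factors.
catalan^ : ℕ → (ℕ → ℕ)
catalan^ zero    = catalan
catalan^ (suc k) = catalan ∗ catalan^ k

-- Irrelevance of _⟶_ says that the edges form a set of ordered pairs, so
-- there are no multiple edges, and the only loop at v is the trivial edge.
record DirectedGraph : Set₁ where
  infix 4 _⟶_ _⇝_
  field
    Vertex       : Set
    _⟶_          : Vertex → Vertex → Set
    ⟶-irrelevant : Irrelevant _⟶_
    trivial      : Reflexive _⟶_

  -- Nontrivial edges.  A proof of u ≢ v is definitionally unique.
  _⇝_ : Vertex → Vertex → Set
  u ⇝ v = u ⟶ v × u ≢ v

  -- Either a single, possibly trivial, edge, or at least two edges, all of
  -- them nontrivial.
  data Path : Vertex → Vertex → Set where
    [_] : ∀ {u v} → u ⟶ v → Path u v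
    _∷_ : ∀ {u v w} → u ⇝ v → TransClosure _⇝_ v w → Path u w

record LabeledGraph (S : Set) : Set₁ where
  field
    graph : DirectedGraph
  open DirectedGraph graph public
  field
    label : Vertex → S

  VertexLabeled : S → Set
  VertexLabeled s = ∃ λ v → label v ≡ s

-- The labels ℕ ∪ {-k, …, -1}.
Label : ℕ → Set
Label k = [ z ∈ ℤ ∣ ℤ.- (+ k) ℤ.≤ z ]

nat : ∀ {k} → ℕ → Label k
nat n = + n , Irr.[ ℤ.neg-≤-pos ]

-- The vertex i : Fin (suc k) carries the label i - k.
linear : (k : ℕ) → LabeledGraph (Label k)
linear k = record
  { graph = record
    { Vertex       = Fin (suc k)
    ; _⟶_          = λ i j → i ≡ j ⊎ toℕ j ≡ suc (toℕ i)
    ; ⟶-irrelevant = irrelevant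
    ; trivial      = inj₁ refl
    }
  ; label = λ i → + toℕ i ℤ.+ ℤ.- (+ k)
                , Irr.[ ℤ.i≤j+i (ℤ.- (+ k)) (+ toℕ i) ]
  }
  where
  irrelevant : Irrelevant (λ (i j : Fin (suc k)) → i ≡ j ⊎ toℕ j ≡ suc (toℕ i))
  irrelevant (inj₁ refl) (inj₁ refl) = refl
  irrelevant (inj₁ refl) (inj₂ q)    = contradiction (sym q) ℕ.1+n≢n
  irrelevant (inj₂ p)    (inj₁ refl) = contradiction (sym p) ℕ.1+n≢n
  irrelevant (inj₂ p)    (inj₂ q)    = cong inj₂ (ℕ.≡-irrelevant p q)

-- Adjoin, for every vertex labeled s and every path ending there, an edge from
-- the initial vertex of the path to a new vertex labeled t.
module Extension {S : Set} (G : LabeledGraph S) (s t : S) where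
  open LabeledGraph G

  record NewVertex : Set where
    constructor newVertex
    field
      {initial terminal} : Vertex
      labeled            : label terminal ≡ s
      path               : Path initial terminal
  open NewVertex public

  data Edge : Vertex ⊎ NewVertex → Vertex ⊎ NewVertex → Set where
    old  : ∀ {u v} → u ⟶ v → Edge (inj₁ u) (inj₁ v)
    new  : ∀ x → Edge (inj₁ (initial x)) (inj₂ x)
    triv : ∀ {x} → Edge (inj₂ x) (inj₂ x)

  Edge-irrelevant : Irrelevant Edge
  Edge-irrelevant (old e) (old f) = cong old (⟶-irrelevant e f)
  Edge-irrelevant (new x) (new .x) = refl
  Edge-irrelevant triv    triv     = refl

  Edge-refl : Reflexive Edge
  Edge-refl {inj₁ _} = old trivial
  Edge-refl {inj₂ _} = triv

  extend : LabeledGraph S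
  extend = record
    { graph = record
      { Vertex       = Vertex ⊎ NewVertex
      ; _⟶_          = Edge
      ; ⟶-irrelevant = Edge-irrelevant
      ; trivial      = Edge-refl
      }
    ; label = λ { (inj₁ v) → label v ; (inj₂ _) → t }
    }

open Extension public using (extend)

actionGraph : (k n : ℕ) → LabeledGraph (Label k)
actionGraph k zero    = linear k
actionGraph k (suc n) = extend (actionGraph k n) (nat n) (nat (suc n))

{-# OPTIONS --safe #-}

-- Every vertex of A^k_n has at most one incoming nontrivial edge, so paths into
-- v correspond to the ancestors of v, one for each depth 0, …, depth v.  The
-- vertices adjoined at v therefore have depths 1, …, depth v + 1.  Since
-- C(x) = 1 + x C(x)² gives C^d_{m+1} = C^1_m + … + C^{d+1}_m, the sum of
-- C^{depth v}_m over the vertices v labeled n in A^k_n does not change under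
-- (n , m + 1) ↦ (n + 1 , m).  For n = 0 it is C^k_m, as the only vertex labeled
-- 0 has depth k; for m = 0 it counts the vertices labeled n.
module Submission where

open import Defs
open import Data.Fin using (Fin; zero; suc; toℕ; fromℕ; fromℕ<; inject₁)
open import Data.Fin.Properties using (toℕ-injective; toℕ-fromℕ; toℕ-fromℕ<; toℕ-inject₁; toℕ<n; +↔⊎)
import Data.Integer as ℤ
import Data.Integer.Properties as ℤ
open import Data.List as List using (applyUpTo)
open import Data.List.Properties using (map-applyUpTo; map-upTo; applyUpTo-∷ʳ)
open import Data.Nat using (ℕ; zero; suc; _+_; _*_; _∸_; _≤_; _<_; s≤s)
open import Data.Nat.ListAction using (sum)
open import Data.Nat.ListAction.Properties using (sum-++)
import Data.Nat.Properties as ℕ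
open import Data.Nat.Solver using (module +-*-Solver)
open import Data.Product using (Σ; ∃; _×_; _,_; proj₁; proj₂)
import Data.Product.Function.Dependent.Propositional as Σ
open import Data.Refinement using (value)
open import Data.Refinement.Properties using (value-injective)
open import Data.Sum as Sum using (_⊎_; inj₁; inj₂)
open import Data.Sum.Function.Propositional using (_⊎-↔_)
open import Axiom.UniquenessOfIdentityProofs.WithK using (uip)
open import Function.Base using (_∘_)
open import Function.Bundles using (_↔_; mk↔ₛ′)
open import Function.Construct.Identity using (↔-id)
open import Function.Related.Propositional using (≡⇒; module EquationalReasoning)
open import Function.Related.TypeIsomorphisms using (Σ-assoc)
open import Relation.Binary.Construct.Closure.Transitive using (TransClosure; [_]; _∷_; _∷ʳ_)
open import Relation.Binary.PropositionalEquality
open import Relation.Nullary using (contradiction)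

-- Convolutions of the Catalan sequence

∗-suc : ∀ a b n → (a ∗ b) (suc n) ≡ a 0 * b (suc n) + (a ∘ suc ∗ b) n
∗-suc a b n = cong (a 0 * b (suc n) +_) (cong sum (trans
  (map-applyUpTo suc (λ m → a m * b (suc n ∸ m)) (suc n))
  (sym (map-upTo (λ m → a (suc m) * b (n ∸ m)) (suc n)))))

-- Shaped for `∗-assoc`: by `∗-suc`, the shift of `a ∗ b` is `a 0` times the shift of `b`, plus
-- `a ∘ suc ∗ b`.
∗-linearˡ : ∀ x a b c n →
            ((λ m → x * a m + b m) ∗ c) n ≡ x * (a ∗ c) n + (b ∗ c) n
∗-linearˡ x a b c zero =
  solve 4 (λ x a b c → (x :* a :+ b) :* c :+ con 0
                    := x :* (a :* c :+ con 0) :+ (b :* c :+ con 0))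
    refl x (a 0) (b 0) (c 0)
  where open +-*-Solver
∗-linearˡ x a b c (suc n) = begin
  ((λ m → x * a m + b m) ∗ c) (suc n)
    ≡⟨ ∗-suc (λ m → x * a m + b m) c n ⟩
  (x * a 0 + b 0) * c (suc n) + ((λ m → x * a (suc m) + b (suc m)) ∗ c) n
    ≡⟨ cong ((x * a 0 + b 0) * c (suc n) +_) (∗-linearˡ x (a ∘ suc) (b ∘ suc) c n) ⟩
  (x * a 0 + b 0) * c (suc n) + (x * (a ∘ suc ∗ c) n + (b ∘ suc ∗ c) n)
    ≡⟨ solve 6 (λ x a b c p q → (x :* a :+ b) :* c :+ (x :* p :+ q)
                             := x :* (a :* c :+ p) :+ (b :* c :+ q))
         refl x (a 0) (b 0) (c (suc n)) ((a ∘ suc ∗ c) n) ((b ∘ suc ∗ c) n) ⟩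
  x * (a 0 * c (suc n) + (a ∘ suc ∗ c) n) + (b 0 * c (suc n) + (b ∘ suc ∗ c) n)
    ≡⟨ cong₂ (λ p q → x * p + q) (∗-suc a c n) (∗-suc b c n) ⟨
  x * (a ∗ c) (suc n) + (b ∗ c) (suc n) ∎
  where
  open ≡-Reasoning
  open +-*-Solver

∗-congˡ : ∀ {a a′} b → a ≗ a′ → a ∗ b ≗ a′ ∗ b
∗-congˡ b a≗a′ n = ∗-cong-≤ {b = b} n (λ {m} _ → a≗a′ m) (λ _ → refl)

-- Induction on the index with the sequences left arbitrary: splitting off `a 0` leaves the claim
-- for `a ∘ suc`.
∗-assoc : ∀ a b c → (a ∗ b) ∗ c ≗ a ∗ (b ∗ c)
∗-assoc a b c zero =
  solve 3 (λ a b c → (a :* b :+ con 0) :* c :+ con 0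
                  := a :* (b :* c :+ con 0) :+ con 0)
    refl (a 0) (b 0) (c 0)
  where open +-*-Solver
∗-assoc a b c (suc n) = begin
  ((a ∗ b) ∗ c) (suc n)
    ≡⟨ ∗-suc (a ∗ b) c n ⟩
  (a ∗ b) 0 * c (suc n) + ((a ∗ b) ∘ suc ∗ c) n
    ≡⟨ cong ((a ∗ b) 0 * c (suc n) +_) (∗-congˡ c (∗-suc a b) n) ⟩
  (a ∗ b) 0 * c (suc n) + ((λ m → a 0 * b (suc m) + (a ∘ suc ∗ b) m) ∗ c) n
    ≡⟨ cong ((a ∗ b) 0 * c (suc n) +_) (∗-linearˡ (a 0) (b ∘ suc) (a ∘ suc ∗ b) c n) ⟩
  (a ∗ b) 0 * c (suc n) + (a 0 * (b ∘ suc ∗ c) n + ((a ∘ suc ∗ b) ∗ c) n)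
    ≡⟨ solve 5 (λ a b c p q → (a :* b :+ con 0) :* c :+ (a :* p :+ q)
                           := a :* (b :* c :+ p) :+ q)
         refl (a 0) (b 0) (c (suc n)) ((b ∘ suc ∗ c) n) (((a ∘ suc ∗ b) ∗ c) n) ⟩
  a 0 * (b 0 * c (suc n) + (b ∘ suc ∗ c) n) + ((a ∘ suc ∗ b) ∗ c) n
    ≡⟨ cong₂ (λ p q → a 0 * p + q) (∗-suc b c n) (sym (∗-assoc (a ∘ suc) b c n)) ⟨
  a 0 * (b ∗ c) (suc n) + (a ∘ suc ∗ (b ∗ c)) n
    ≡⟨ ∗-suc a (b ∗ c) n ⟨
  (a ∗ (b ∗ c)) (suc n) ∎
  where
  open ≡-Reasoning
  open +-*-Solver

catalan^-zero : ∀ k → catalan^ k 0 ≡ 1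
catalan^-zero zero    = refl
catalan^-zero (suc k) = cong (λ c → 1 * c + 0) (catalan^-zero k)

-- The generating function of `catalan^ k` is C(x)^(k+1). Multiply C(x) = 1 + x C(x)² by it and
-- compare coefficients of x^(n+1).
catalan^-suc-suc : ∀ k n →
  catalan^ (suc k) (suc n) ≡ catalan^ k (suc n) + catalan^ (suc (suc k)) n
catalan^-suc-suc k n = begin
  (catalan ∗ catalan^ k) (suc n)
    ≡⟨ ∗-suc catalan (catalan^ k) n ⟩
  1 * catalan^ k (suc n) + (catalan ∘ suc ∗ catalan^ k) n
    ≡⟨ cong₂ _+_ (ℕ.*-identityˡ (catalan^ k (suc n))) (∗-congˡ (catalan^ k) catalan-suc n) ⟩
  catalan^ k (suc n) + ((catalan ∗ catalan) ∗ catalan^ k) n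
    ≡⟨ cong (catalan^ k (suc n) +_) (∗-assoc catalan catalan (catalan^ k) n) ⟩
  catalan^ k (suc n) + catalan^ (suc (suc k)) n ∎
  where open ≡-Reasoning

sum-applyUpTo-suc : ∀ f n → sum (applyUpTo f (suc n)) ≡ sum (applyUpTo f n) + f n
sum-applyUpTo-suc f n = begin
  sum (applyUpTo f (suc n))                ≡⟨ cong sum (applyUpTo-∷ʳ f n) ⟨
  sum (applyUpTo f n List.++ List.[ f n ]) ≡⟨ sum-++ (applyUpTo f n) List.[ f n ] ⟩
  sum (applyUpTo f n) + (f n + 0)          ≡⟨ cong (sum (applyUpTo f n) +_) (ℕ.+-identityʳ (f n)) ⟩
  sum (applyUpTo f n) + f n                ∎
  where open ≡-Reasoning

-- `catalan^-suc-suc` unrolls down to the Catalan recurrence at `k = 0`. The `suc k` summands will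
-- match the paths into a vertex of depth `k`.
catalan^-suc : ∀ k n →
  catalan^ k (suc n) ≡ sum (applyUpTo (λ i → catalan^ (suc i) n) (suc k))
catalan^-suc zero    n = trans (catalan-suc n) (sym (ℕ.+-identityʳ _))
catalan^-suc (suc k) n = begin
  catalan^ (suc k) (suc n)
    ≡⟨ catalan^-suc-suc k n ⟩
  catalan^ k (suc n) + catalan^ (suc (suc k)) n
    ≡⟨ cong (_+ catalan^ (suc (suc k)) n) (catalan^-suc k n) ⟩
  sum (applyUpTo (λ i → catalan^ (suc i) n) (suc k)) + catalan^ (suc (suc k)) n
    ≡⟨ sum-applyUpTo-suc (λ i → catalan^ (suc i) n) (suc k) ⟨
  sum (applyUpTo (λ i → catalan^ (suc i) n) (suc (suc k))) ∎
  where open ≡-Reasoning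

-- Sums as disjoint unions

Σ-Fin-suc : ∀ {n} (B : Fin (suc n) → Set) → Σ (Fin (suc n)) B ↔ (B zero ⊎ Σ (Fin n) (B ∘ suc))
Σ-Fin-suc B = mk↔ₛ′
  (λ { (zero , b) → inj₁ b ; (suc i , b) → inj₂ (i , b) })
  (λ { (inj₁ b) → zero , b ; (inj₂ (i , b)) → suc i , b })
  (λ { (inj₁ b) → refl ; (inj₂ (i , b)) → refl })
  (λ { (zero , b) → refl ; (suc i , b) → refl })

Σ-Fin↔sum : ∀ n f → Σ (Fin n) (Fin ∘ f ∘ toℕ) ↔ Fin (sum (applyUpTo f n))
Σ-Fin↔sum zero    f = mk↔ₛ′ (λ ()) (λ ()) (λ ()) (λ ())
Σ-Fin↔sum (suc n) f =
  Σ (Fin (suc n)) (Fin ∘ f ∘ toℕ)               ↔⟨ Σ-Fin-suc (Fin ∘ f ∘ toℕ) ⟩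
  (Fin (f 0) ⊎ Σ (Fin n) (Fin ∘ f ∘ suc ∘ toℕ)) ↔⟨ ↔-id _ ⊎-↔ Σ-Fin↔sum n (f ∘ suc) ⟩
  (Fin (f 0) ⊎ Fin (sum (applyUpTo (f ∘ suc) n))) ↔⟨ +↔⊎ ⟨
  Fin (sum (applyUpTo f (suc n)))               ∎
  where open EquationalReasoning

-- Paths in forests

-- Roots are the vertices of depth 0. The depth equations in `parent-unique` exclude trivial edges.
record Forest (G : DirectedGraph) : Set where
  open DirectedGraph G
  field
    depth         : Vertex → ℕ
    edge-depth    : ∀ {u v} → u ⟶ v → u ≡ v ⊎ depth v ≡ suc (depth u)
    parent        : ∀ v {d} → depth v ≡ suc d → ∃ λ u → u ⟶ v × depth u ≡ d
    parent-unique : ∀ {u v w} → u ⟶ w → v ⟶ w →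
                    depth w ≡ suc (depth u) → depth w ≡ suc (depth v) → u ≡ v

  ⇝-depth : ∀ {u v} → u ⇝ v → depth v ≡ suc (depth u)
  ⇝-depth (e , u≢v) with edge-depth e
  ... | inj₁ u≡v = contradiction u≡v u≢v
  ... | inj₂ eq  = eq

  ⁺-depth : ∀ {u v} → TransClosure _⇝_ u v → depth u < depth v
  ⁺-depth [ e ]   = ℕ.≤-reflexive (sym (⇝-depth e))
  ⁺-depth (e ∷ p) = ℕ.<-trans (ℕ.≤-reflexive (sym (⇝-depth e))) (⁺-depth p)

  ⇝-unique : ∀ {u v w} (e : u ⇝ w) (f : v ⇝ w) → (u , e) ≡ (v , f)
  ⇝-unique (e , u≢w) (f , v≢w)
    with refl ← parent-unique e f (⇝-depth (e , u≢w)) (⇝-depth (f , v≢w))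
    -- The inequality components of the two edges agree definitionally.
    with refl ← ⟶-irrelevant e f = refl

  -- Each nontrivial edge raises the depth by one, so equal starting depths force equal lengths, and
  -- going back from `w` there is never a choice of edge.
  ⁺-unique : ∀ {u v w} (p : TransClosure _⇝_ u w) (q : TransClosure _⇝_ v w) →
             depth u ≡ depth v → (u , p) ≡ (v , q)
  ⁺-unique [ e ]   [ f ]   _  with refl ← ⇝-unique e f = refl
  -- If only one path is a single edge, the second vertex of the longer one has the depth of `w`,
  -- yet a path of positive length leads from it to `w`.
  ⁺-unique [ e ]   (f ∷ q) eq = contradiction
    (trans (⇝-depth f) (trans (cong suc (sym eq)) (sym (⇝-depth e)))) (ℕ.<⇒≢ (⁺-depth q))
  ⁺-unique (e ∷ p) [ f ]   eq = contradiction
    (trans (⇝-depth e) (trans (cong suc eq) (sym (⇝-depth f)))) (ℕ.<⇒≢ (⁺-depth p))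
  ⁺-unique (e ∷ p) (f ∷ q) eq
    with refl ← ⁺-unique p q (trans (⇝-depth e) (trans (cong suc eq) (sym (⇝-depth f))))
    with refl ← ⇝-unique e f = refl

  parent-⇝ : ∀ v {d} → depth v ≡ suc d → ∃ λ u → u ⇝ v × depth u ≡ d
  parent-⇝ v eq with u , e , eq′ ← parent v eq =
    u , (e , λ { refl → ℕ.1+n≢n (trans (sym eq) eq′) }) , eq′

  -- Climb from `v` through parents until depth `i` is reached. The climb meets the last edge first,
  -- hence `∷ʳ`.
  ⁺-from : ∀ v {d i} → depth v ≡ d → i < d → ∃ λ u → TransClosure _⇝_ u v × depth u ≡ i
  ⁺-from v {suc d} eq i<1+d with w , e , eq′ ← parent-⇝ v eq | ℕ.m<1+n⇒m<n∨m≡n i<1+d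
  ... | inj₂ refl = w , [ e ] , eq′
  ... | inj₁ i<d with u , p , eq″ ← ⁺-from w eq′ i<d = u , p ∷ʳ e , eq″

  PathTo : Vertex → Set
  PathTo v = ∃ λ u → Path u v

  toPath : ∀ {u v} → TransClosure _⇝_ u v → Path u v
  toPath [ e ]   = [ proj₁ e ]
  toPath (e ∷ p) = e ∷ p

  -- The constructor `[_]` of `Path` mixes trivial and nontrivial edges; the view splits off the
  -- trivial path and puts all others in the form of a `TransClosure`.
  data View {v} : PathTo v → Set where
    isTrivial    : View (v , [ trivial ])
    isNontrivial : ∀ {u} (p : TransClosure _⇝_ u v) → View (u , toPath p)

  view : ∀ {v} (p : PathTo v) → View p
  view (_ , e ∷ p) = isNontrivial (e ∷ p)
  -- `edge-depth` decides whether the edge is a loop; a loop is `trivial` by irrelevance.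
  view (_ , [ e ]) with edge-depth e
  ... | inj₁ refl rewrite ⟶-irrelevant e trivial = isTrivial
  ... | inj₂ eq = isNontrivial [ e , (λ { refl → ℕ.1+n≢n (sym eq) }) ]

  path-depth : ∀ {v} (p : PathTo v) → depth (proj₁ p) ≤ depth v
  path-depth p with view p
  ... | isTrivial      = ℕ.≤-refl
  ... | isNontrivial q = ℕ.<⇒≤ (⁺-depth q)

  path-unique : ∀ {v} (p q : PathTo v) → depth (proj₁ p) ≡ depth (proj₁ q) → p ≡ q
  path-unique p q eq with view p | view q
  ... | isTrivial       | isTrivial       = refl
  ... | isTrivial       | isNontrivial q′ = contradiction (sym eq) (ℕ.<⇒≢ (⁺-depth q′))
  ... | isNontrivial p′ | isTrivial       = contradiction eq (ℕ.<⇒≢ (⁺-depth p′))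
  ... | isNontrivial p′ | isNontrivial q′ with refl ← ⁺-unique p′ q′ eq = refl

  path-from : ∀ v {i} → i ≤ depth v → ∃ λ (p : PathTo v) → depth (proj₁ p) ≡ i
  path-from v i≤d with ℕ.m≤n⇒m<n∨m≡n i≤d
  ... | inj₂ refl = (v , [ trivial ]) , refl
  ... | inj₁ i<d with u , p , eq ← ⁺-from v refl i<d = (u , toPath p) , eq

  -- A path is coded by the depth of its initial vertex: `path-from` realizes every depth up to that
  -- of `v`, and `path-unique` allows each only once.
  PathTo↔Fin : ∀ v → PathTo v ↔ Fin (suc (depth v))
  PathTo↔Fin v = mk↔ₛ′ to from
    (λ i → toℕ-injective (trans (toℕ-fromℕ< _) (proj₂ (at i))))
    (λ p → path-unique _ p (trans (proj₂ (at (to p))) (toℕ-fromℕ< _)))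
    where
    to : PathTo v → Fin (suc (depth v))
    to p = fromℕ< (s≤s (path-depth p))
    at : (i : Fin (suc (depth v))) → ∃ λ (p : PathTo v) → depth (proj₁ p) ≡ toℕ i
    at i = path-from v (ℕ.≤-pred (toℕ<n i))
    from : Fin (suc (depth v)) → PathTo v
    from = proj₁ ∘ at

  Σ-PathTo : ∀ v (B : ℕ → Set) →
             Σ (PathTo v) (B ∘ depth ∘ proj₁) ↔ Σ (Fin (suc (depth v))) (B ∘ toℕ)
  Σ-PathTo v B = Σ.cong (PathTo↔Fin v)
    (λ {p} → ≡⇒ (cong B (sym (toℕ-fromℕ< (s≤s (path-depth p))))))

-- Action graphs

linear-forest : ∀ k → Forest (LabeledGraph.graph (linear k))
linear-forest k = record
  { depth         = toℕ
  ; edge-depth    = λ e → e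
  ; parent        = parent
  ; parent-unique = λ _ _ p q → toℕ-injective (ℕ.suc-injective (trans (sym p) q))
  }
  where
  parent : ∀ (j : Fin (suc k)) {d} → toℕ j ≡ suc d →
           ∃ λ i → (i ≡ j ⊎ toℕ j ≡ suc (toℕ i)) × toℕ i ≡ d
  parent (suc j) refl = inject₁ j , inj₂ (cong suc (sym (toℕ-inject₁ j))) , toℕ-inject₁ j

module _ {S : Set} {G : LabeledGraph S} (F : Forest (LabeledGraph.graph G)) (s t : S) where
  open Extension G s t hiding (extend)
  open LabeledGraph G using (Vertex)
  private module F = Forest F

  -- A new vertex hangs as a leaf under the initial vertex of its path, not under the terminal one,
  -- and old vertices gain no incoming edges.
  extend-forest : Forest (LabeledGraph.graph (extend G s t))
  extend-forest = record
    { depth         = depth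
    ; edge-depth    = edge-depth
    ; parent        = parent
    ; parent-unique = parent-unique
    }
    where
    depth : Vertex ⊎ NewVertex → ℕ
    depth (inj₁ v) = F.depth v
    depth (inj₂ x) = suc (F.depth (initial x))

    edge-depth : ∀ {u v} → Edge u v → u ≡ v ⊎ depth v ≡ suc (depth u)
    edge-depth (old e) = Sum.map₁ (cong inj₁) (F.edge-depth e)
    edge-depth (new x) = inj₂ refl
    edge-depth triv    = inj₁ refl

    parent : ∀ v {d} → depth v ≡ suc d → ∃ λ u → Edge u v × depth u ≡ d
    parent (inj₁ v) eq with u , e , eq′ ← F.parent v eq = inj₁ u , old e , eq′
    parent (inj₂ x) eq = inj₁ (initial x) , new x , ℕ.suc-injective eq

    parent-unique : ∀ {u v w} → Edge u w → Edge v w →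
                    depth w ≡ suc (depth u) → depth w ≡ suc (depth v) → u ≡ v
    parent-unique (old e) (old f) p q = cong inj₁ (F.parent-unique e f p q)
    parent-unique (new x) (new x) _ _ = refl
    parent-unique (new x) triv    _ q = contradiction (sym q) ℕ.1+n≢n
    parent-unique triv    _       p _ = contradiction (sym p) ℕ.1+n≢n

forest : ∀ k n → Forest (LabeledGraph.graph (actionGraph k n))
forest k zero    = linear-forest k
forest k (suc n) = extend-forest (forest k n) (nat n) (nat (suc n))

-- Ensures that at the next stage the vertices labeled `n + 1` are exactly the new ones.
label≤n : ∀ k n v → value (LabeledGraph.label (actionGraph k n) v) ℤ.≤ ℤ.+ n
label≤n k zero    v        = ℤ.i≤j⇒i-j≤0 (ℤ.+≤+ (ℕ.≤-pred (toℕ<n v)))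
label≤n k (suc n) (inj₁ v) = ℤ.≤-trans (label≤n k n v) (ℤ.+≤+ (ℕ.n≤1+n n))
label≤n k (suc n) (inj₂ x) = ℤ.≤-refl

module _ (k n : ℕ) where
  open LabeledGraph (actionGraph k n) using (Vertex; Path; label; VertexLabeled)
  open Forest (forest k n)
  open Extension (actionGraph k n) (nat n) (nat (suc n)) using (newVertex)
  private module Next = LabeledGraph (actionGraph k (suc n))

  extended : ∀ (x : Σ (VertexLabeled (nat n)) (PathTo ∘ proj₁)) → Next.VertexLabeled (nat (suc n))
  extended ((_ , labeled) , _ , p) = inj₂ (newVertex labeled p) , refl

  VertexLabeled-suc : Σ (VertexLabeled (nat n)) (PathTo ∘ proj₁) ↔ Next.VertexLabeled (nat (suc n))
  VertexLabeled-suc = mk↔ₛ′ extended from extended∘from (λ _ → refl)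
    where
    old-label≢ : ∀ {v} → label v ≢ nat (suc n)
    old-label≢ {v} eq = ℕ.1+n≰n (ℤ.drop‿+≤+ (subst (ℤ._≤ ℤ.+ n) (cong value eq) (label≤n k n v)))

    from : Next.VertexLabeled (nat (suc n)) → Σ (VertexLabeled (nat n)) (PathTo ∘ proj₁)
    from (inj₁ v , eq)                    = contradiction eq old-label≢
    from (inj₂ (newVertex labeled p) , _) = (_ , labeled) , _ , p

    extended∘from : ∀ y → extended (from y) ≡ y
    extended∘from (inj₁ v , eq)                     = contradiction eq old-label≢
    -- `from` forgets the label proof and `extended` supplies `refl`; the two proofs agree by
    -- uniqueness of identity proofs.
    extended∘from (inj₂ (newVertex labeled p) , eq) = cong (_ ,_) (uip refl eq)

-- The label `i - k` vanishes only at `i = k`, so there is one summand. It is transported because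
-- `toℕ (fromℕ k)` equals `k` only propositionally.
linear-VertexLabeled : ∀ k (B : ℕ → Set) →
  Σ (LabeledGraph.VertexLabeled (linear k) (nat 0)) (B ∘ toℕ ∘ proj₁) ↔ B k
linear-VertexLabeled k B = mk↔ₛ′ to from to∘from from∘to
  where
  open LabeledGraph (linear k)
  top : VertexLabeled (nat 0)
  top = fromℕ k , value-injective (ℤ.i≡j⇒i-j≡0 (cong ℤ.+_ (toℕ-fromℕ k)))
  depth≡k : (v : VertexLabeled (nat 0)) → toℕ (proj₁ v) ≡ k
  depth≡k (i , eq) = ℤ.+-injective (ℤ.i-j≡0⇒i≡j (ℤ.+ toℕ i) (ℤ.+ k) (cong value eq))
  to : Σ (VertexLabeled (nat 0)) (B ∘ toℕ ∘ proj₁) → B k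
  to (v , b) = subst B (depth≡k v) b
  from : B k → Σ (VertexLabeled (nat 0)) (B ∘ toℕ ∘ proj₁)
  from b = top , subst B (sym (depth≡k top)) b
  to∘from : ∀ b → to (from b) ≡ b
  to∘from b = subst-subst-sym (depth≡k top)
  from∘to : ∀ x → from (to x) ≡ x
  from∘to (v@(i , eq) , b)
    -- Identify first the vertex, then its label proof, with those of `top`; the two transports then
    -- cancel.
    with refl ← toℕ-injective {i = fromℕ k} (trans (toℕ-fromℕ k) (sym (depth≡k v)))
    with refl ← uip (proj₂ top) eq = cong (top ,_) (subst-sym-subst (depth≡k top))

-- Induction on `n` for all `m`. Count the vertices adjoined at `v` as its children: the weight
-- `catalan^ d m` of a vertex of depth `d` is then the number of its descendants `m` stages later.
Σ-VertexLabeled : ∀ k n m → let open LabeledGraph (actionGraph k n); open Forest (forest k n) in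
  Σ (VertexLabeled (nat n)) (λ v → Fin (catalan^ (depth (proj₁ v)) m)) ↔ Fin (catalan^ k (n + m))
Σ-VertexLabeled k zero    m = linear-VertexLabeled k (λ d → Fin (catalan^ d m))
Σ-VertexLabeled k (suc n) m =
  Σ (Next.VertexLabeled (nat (suc n))) (λ v → Fin (catalan^ (depth⁺ (proj₁ v)) m))
    -- The depth of a new vertex reduces to `suc` of the depth of its path's initial vertex, so the
    -- fibres match definitionally.
    ↔⟨ Σ.cong (VertexLabeled-suc k n) (↔-id _) ⟨
  Σ (Σ (VertexLabeled (nat n)) (PathTo ∘ proj₁)) (λ { (_ , p) → Fin (catalan^ (suc (depth (proj₁ p))) m) })
    ↔⟨ Σ-assoc ⟩
  Σ (VertexLabeled (nat n)) (λ v → Σ (PathTo (proj₁ v)) λ p → Fin (catalan^ (suc (depth (proj₁ p))) m))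
    ↔⟨ Σ.cong (↔-id _) (λ {v} → children (proj₁ v)) ⟩
  Σ (VertexLabeled (nat n)) (λ v → Fin (catalan^ (depth (proj₁ v)) (suc m)))
    ↔⟨ Σ-VertexLabeled k n (suc m) ⟩
  Fin (catalan^ k (n + suc m))
    ↔⟨ ≡⇒ (cong (Fin ∘ catalan^ k) (ℕ.+-suc n m)) ⟩
  Fin (catalan^ k (suc n + m)) ∎
  where
  open EquationalReasoning
  open LabeledGraph (actionGraph k n)
  open Forest (forest k n)
  module Next = LabeledGraph (actionGraph k (suc n))
  open Forest (forest k (suc n)) using () renaming (depth to depth⁺)

  -- The children of `v` have depths 1 to `suc (depth v)`, once each, and their weights add up by
  -- `catalan^-suc`.
  children : ∀ v → Σ (PathTo v) (λ p → Fin (catalan^ (suc (depth (proj₁ p))) m)) ↔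
                   Fin (catalan^ (depth v) (suc m))
  children v =
    Σ (PathTo v) (λ p → Fin (catalan^ (suc (depth (proj₁ p))) m))
      ↔⟨ Σ-PathTo v (λ d → Fin (catalan^ (suc d) m)) ⟩
    Σ (Fin (suc (depth v))) (λ i → Fin (catalan^ (suc (toℕ i)) m))
      ↔⟨ Σ-Fin↔sum (suc (depth v)) (λ d → catalan^ (suc d) m) ⟩
    Fin (sum (applyUpTo (λ d → catalan^ (suc d) m) (suc (depth v))))
      ↔⟨ ≡⇒ (cong Fin (catalan^-suc (depth v) m)) ⟨
    Fin (catalan^ (depth v) (suc m)) ∎

theorem3p1 : (k n : ℕ) → LabeledGraph.VertexLabeled (actionGraph k n) (nat n) ↔ Fin (catalan^ k n)
theorem3p1 k n =
  VertexLabeled (nat n)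
    -- Counting is the case `m = 0`, where every vertex has weight 1 whatever its depth.
    ↔⟨ mk↔ₛ′ proj₁ (_, zero) (λ _ → refl) (λ { (_ , zero) → refl }) ⟨
  (VertexLabeled (nat n) × Fin 1)
    ↔⟨ Σ.cong (↔-id _) (λ {v} → ≡⇒ (cong Fin (sym (catalan^-zero (depth (proj₁ v)))))) ⟩
  Σ (VertexLabeled (nat n)) (λ v → Fin (catalan^ (depth (proj₁ v)) 0))
    ↔⟨ Σ-VertexLabeled k n 0 ⟩
  Fin (catalan^ k (n + 0))
    ↔⟨ ≡⇒ (cong (Fin ∘ catalan^ k) (ℕ.+-identityʳ n)) ⟩
  Fin (catalan^ k n) ∎
  where
  open EquationalReasoning
  open LabeledGraph (actionGraph k n)
  open Forest (forest k n)
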